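{- For every QPTL formula $\varphi$ and every hyperassignment $\mathcal X\in\mathrm{HAsg}_\supseteq(\mathrm{free}(\varphi))$: (1) $\mathcal X\models^{\exists\forall}\varphi$ iff there exists $X\in\mathcal X$ such that $\chi\models\varphi$ for all $\chi\in X$; (2) $\mathcal X\models^{\forall\exists}\varphi$ iff for every $X\in\mathcal X$ there is $\chi\in X$ with $\chi\models\varphi$, where on the right-hand sides $\models$ is the Tarski semantics.
   Context: Let $AP$ be a set of atomic propositions and $\mathbb B=\{\top,\bot\}$. A temporal valuation is a function $f:\mathbb N\to\mathbb B$. An assignment is a partial function $\chi:AP\rightharpoonup(\mathbb N\to\mathbb B)$; $\mathrm{Asg}$ is the set of all assignments, $\mathrm{Asg}(P)$ the set of assignments with domain exactly $P\subseteq AP$, and $\mathrm{Asg}_\supseteq(P)$ the set of assignments whose domain contains $P$. For an assignment $\chi$, $p\in AP$ and a temporal valuation $f$, $\chi[p\mapsto f]$ is the assignment that agrees with $\chi$ except that it maps $p$ to $f$. Tarski semantics of QPTL (formulas $\varphi::=\psi\mid\neg\varphi\mid\varphi\wedge\varphi\mid\varphi\vee\varphi\mid\exists p.\varphi\mid\forall p.\varphi$, $\psi$ LTL), for $\chi\in\mathrm{Asg}_\supseteq(\mathrm{free}(\varphi))$: $\chi\models\psi$ iff $\chi\models_{LTL}\psi$ (see below); Boolean connectives as usual; $\chi\models\exists p.\phi$ iff $\chi[p\mapsto f]\models\phi$ for some temporal valuation $f$; $\chi\models\forall p.\phi$ iff for all $f$. A hyperassignment is a set $\mathcal X$ with $\emptyset\neq\mathcal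 X\subseteq 2^{\mathrm{Asg}(P)}$ and $\emptyset\notin\mathcal X$, for some $P\subseteq AP$; this $P$ is denoted $\mathrm{ap}(\mathcal X)$. $\mathrm{HAsg}$ is the set of all hyperassignments, $\mathrm{HAsg}(P)$ those with $\mathrm{ap}(\mathcal X)=P$, and $\mathrm{HAsg}_\supseteq(P)$ those with $\mathrm{ap}(\mathcal X)\supseteq P$. A choice function for $\mathcal X$ is a map $c:\mathcal X\to\mathrm{Asg}$ with $c(X)\in X$ for all $X\in\mathcal X$. The dual of $\mathcal X$ is $\overline{\mathcal X}=\{\mathrm{img}(c): c\text{ a choice function for }\mathcal X\}$. $\mathrm{par}(\mathcal X)$ is the set of pairs $(\mathcal X_1,\mathcal X_2)$ of (possibly empty) subsets of $\mathcal X$ with $\mathcal X_1\cap\mathcal X_2=\emptyset$ and $\mathcal X_1\cup\mathcal X_2=\mathcal X$. A functor over $P\subseteq AP$ is a function $F:\mathrm{Asg}(P)\to(\mathbb N\to\mathbb B)$; $\mathrm{Fnc}(P)$ is the set of all functors over $P$. For $\chi\in\mathrm{Asg}(P)$, $F\in\mathrm{Fnc}(P)$ and $p\in AP$, $\mathrm{ext}(\chi,F,p)=\chi[p\mapsto F(\chi)]$; for $X\subseteq\mathrm{Asg}(P)$, $\mathrm{ext}(X,F,p)=\{\mathrm{ext}(\chi,F,p):\chi\in X\}$; for a hyperassignment $\mathcal X$, $\mathrm{ext}(\mathcal X,p)=\{\mathrm{ext}(X,F,p):X\in\mathcal X,\ F\in\mathrm{Fnc}(\mathrm{ap}(\mathcal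 X))\}$. $\chi\models_{LTL}\psi$ iff the infinite word whose $t$-th letter is the valuation $q\mapsto\chi(q)(t)$ satisfies the LTL formula $\psi$ in the standard sense. Alternation flags are $\exists\forall$ and $\forall\exists$; $\bar\alpha$ denotes the flag different from $\alpha$. Alternating Hodges semantics of QPTL: for a QPTL formula $\varphi$, $\mathcal X\in\mathrm{HAsg}_\supseteq(\mathrm{free}(\varphi))$ and flag $\alpha$, $\mathcal X\models^\alpha\varphi$ is defined inductively: (1) for LTL $\psi$: $\mathcal X\models^{\exists\forall}\psi$ iff there is $X\in\mathcal X$ with $\chi\models_{LTL}\psi$ for all $\chi\in X$; $\mathcal X\models^{\forall\exists}\psi$ iff for every $X\in\mathcal X$ there is $\chi\in X$ with $\chi\models_{LTL}\psi$; (2) $\mathcal X\models^\alpha\neg\phi$ iff not $\mathcal X\models^{\bar\alpha}\phi$; (3) $\mathcal X\models^{\exists\forall}\phi_1\wedge\phi_2$ iff for every $(\mathcal X_1,\mathcal X_2)\in\mathrm{par}(\mathcal X)$, either ($\mathcal X_1\ne\emptyset$ and $\mathcal X_1\models^{\exists\forall}\phi_1$) or ($\mathcal X_2\ne\emptyset$ and $\mathcal X_2\models^{\exists\forall}\phi_2$); $\mathcal X\models^{\forall\exists}\phi_1\wedge\phi_2$ iff $\overline{\mathcal X}\models^{\exists\forall}\phi_1\wedge\phi_2$; (4) $\mathcal X\models^{\forall\exists}\phi_1\vee\phi_2$ iff there is $(\mathcal X_1,\mathcal X_2)\in\mathrm{par}(\mathcal X)$ such that ($\mathcal X_1\neq\emptyset$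 implies $\mathcal X_1\models^{\forall\exists}\phi_1$) and ($\mathcal X_2\neq\emptyset$ implies $\mathcal X_2\models^{\forall\exists}\phi_2$); $\mathcal X\models^{\exists\forall}\phi_1\vee\phi_2$ iff $\overline{\mathcal X}\models^{\forall\exists}\phi_1\vee\phi_2$; (5) $\mathcal X\models^{\exists\forall}\exists p.\phi$ iff $\mathrm{ext}(\mathcal X,p)\models^{\exists\forall}\phi$; $\mathcal X\models^{\forall\exists}\exists p.\phi$ iff $\overline{\mathcal X}\models^{\exists\forall}\exists p.\phi$; (6) $\mathcal X\models^{\forall\exists}\forall p.\phi$ iff $\mathrm{ext}(\mathcal X,p)\models^{\forall\exists}\phi$; $\mathcal X\models^{\exists\forall}\forall p.\phi$ iff $\overline{\mathcal X}\models^{\forall\exists}\forall p.\phi$. -}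

module Defs where

open import Level using (0ℓ)
open import Axiom.ExcludedMiddle using (ExcludedMiddle)
open import Data.Bool using (Bool; false; T)
open import Data.Nat using (ℕ; suc; _≤_; _<_)
open import Data.Product using (Σ-syntax; ∃-syntax; _×_; _,_)
open import Data.Sum using (_⊎_; inj₁; inj₂)
open import Data.Unit using (⊤)
open import Function.Bundles using (_⇔_)
open import Relation.Binary.PropositionalEquality using (_≡_; refl)
open import Relation.Nullary using (Dec; ¬_; yes; no; contradiction)
open import Relation.Nullary.Decidable using (isYes; toWitness; fromWitness)

-- The underlying theory is classical.  Excluded middle is a parameter; it is
-- used in the definitions only to form subsets by comprehension and to decide
-- equality and membership in AP.  Since the library's form of it decides every type, it
-- also gives choice.
module Semantics (em : ExcludedMiddle 0ℓ) (AP : Set) where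

  infix  4 _∈_ _⊆_
  infixr 6 _∪_

  -- Subsets as characteristic functions, so that membership is a proposition
  -- (T b has at most one element): a function defined on the elements of a
  -- subset cannot depend on the proof of membership.
  𝒫 : Set → Set
  𝒫 A = A → Bool

  _∈_ : {A : Set} → A → 𝒫 A → Set
  x ∈ X = T (X x)

  _⊆_ : {A : Set} → 𝒫 A → 𝒫 A → Set
  X ⊆ Y = ∀ x → x ∈ X → x ∈ Y

  comprehension : {A : Set} → (A → Set) → 𝒫 A
  comprehension Q x = isYes (em {Q x})

  syntax comprehension (λ x → Q) = ⟅ x ∣ Q ⟆

  ∈⁺ : {A : Set} (Q : A → Set) {x : A} → Q x → x ∈ comprehension Q
  ∈⁺ Q {x} = fromWitness {a? = em {Q x}}

  ∈⁻ : {A : Set} (Q : A → Set) {x : A} → x ∈ comprehension Q → Q x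
  ∈⁻ Q {x} = toWitness {a? = em {Q x}}

  Nonempty : {A : Set} → 𝒫 A → Set
  Nonempty X = ∃[ x ] x ∈ X

  ｛_｝ : {A : Set} → A → 𝒫 A
  ｛ a ｝ = ⟅ x ∣ x ≡ a ⟆

  _∪_ _∖_ : {A : Set} → 𝒫 A → 𝒫 A → 𝒫 A
  X ∪ Y = ⟅ x ∣ (x ∈ X ⊎ x ∈ Y) ⟆
  X ∖ Y = ⟅ x ∣ (x ∈ X × ¬ (x ∈ Y)) ⟆

  ∪-⊆ˡ : {A : Set} {X Y Z : 𝒫 A} → X ∪ Y ⊆ Z → X ⊆ Z
  ∪-⊆ˡ {X = X} {Y} h x m = h x (∈⁺ (λ x → x ∈ X ⊎ x ∈ Y) (inj₁ m))

  ∪-⊆ʳ : {A : Set} {X Y Z : 𝒫 A} → X ∪ Y ⊆ Z → Y ⊆ Z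
  ∪-⊆ʳ {X = X} {Y} h x m = h x (∈⁺ (λ x → x ∈ X ⊎ x ∈ Y) (inj₂ m))

  ∖-⊆ : {A : Set} {X Y Z : 𝒫 A} → X ∖ Y ⊆ Z → X ⊆ Z ∪ Y
  ∖-⊆ {X = X} {Y} {Z} h x m with em {x ∈ Y}
  ... | yes y = ∈⁺ (λ x → x ∈ Z ⊎ x ∈ Y) (inj₂ y)
  ... | no ¬y = ∈⁺ (λ x → x ∈ Z ⊎ x ∈ Y)
                  (inj₁ (h x (∈⁺ (λ x → x ∈ X × ¬ (x ∈ Y)) (m , ¬y))))

  TemporalValuation : Set
  TemporalValuation = ℕ → Bool

  -- Asg P is the set of assignments with domain exactly P.
  Asg : 𝒫 AP → Set
  Asg P = (q : AP) → q ∈ P → TemporalValuation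

  _[_↦_] : {P : 𝒫 AP} → Asg P → (p : AP) → TemporalValuation → Asg (P ∪ ｛ p ｝)
  _[_↦_] {P} χ p f q m = value em
    where
      remaining : ¬ (q ≡ p) → q ∈ P ⊎ q ∈ ｛ p ｝ → q ∈ P
      remaining q≢p (inj₁ q∈P) = q∈P
      remaining q≢p (inj₂ q∈p) = contradiction (∈⁻ (λ q → q ≡ p) q∈p) q≢p

      value : Dec (q ≡ p) → TemporalValuation
      value (yes _)  = f
      value (no q≢p) = χ q (remaining q≢p (∈⁻ (λ q → q ∈ P ⊎ q ∈ ｛ p ｝) m))

  infix  9 ○_
  infix  9 ¬ˡ_ `¬_
  infixr 8 _𝒰_
  infixr 7 _∧ˡ_ _`∧_
  infixr 6 _∨ˡ_ _`∨_
  infix  5 `∃_∙_ `∀_∙_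

  -- The remaining usual operators (F, G, R, …) are abbreviations.
  data LTL : Set where
    true      : LTL
    atom      : AP → LTL
    ¬ˡ_       : LTL → LTL
    _∧ˡ_ _∨ˡ_ : LTL → LTL → LTL
    ○_        : LTL → LTL
    _𝒰_       : LTL → LTL → LTL

  data QPTL : Set where
    ltl         : LTL → QPTL
    `¬_         : QPTL → QPTL
    _`∧_ _`∨_   : QPTL → QPTL → QPTL
    `∃_∙_ `∀_∙_ : AP → QPTL → QPTL

  atoms : LTL → 𝒫 AP
  atoms true       = λ _ → false
  atoms (atom p)   = ｛ p ｝
  atoms (¬ˡ ψ)     = atoms ψ
  atoms (ψ₁ ∧ˡ ψ₂) = atoms ψ₁ ∪ atoms ψ₂
  atoms (ψ₁ ∨ˡ ψ₂) = atoms ψ₁ ∪ atoms ψ₂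
  atoms (○ ψ)      = atoms ψ
  atoms (ψ₁ 𝒰 ψ₂)  = atoms ψ₁ ∪ atoms ψ₂

  free : QPTL → 𝒫 AP
  free (ltl ψ)    = atoms ψ
  free (`¬ φ)     = free φ
  free (φ₁ `∧ φ₂) = free φ₁ ∪ free φ₂
  free (φ₁ `∨ φ₂) = free φ₁ ∪ free φ₂
  free (`∃ p ∙ φ) = free φ ∖ ｛ p ｝
  free (`∀ p ∙ φ) = free φ ∖ ｛ p ｝

  Word : 𝒫 AP → Set
  Word P = ℕ → (q : AP) → q ∈ P → Bool

  word : {P : 𝒫 AP} → Asg P → Word P
  word χ t q m = χ q m t

  -- In all three satisfaction relations the last argument, in brackets, is the
  -- proof that the propositions occurring (free) in the formula lie in P.

  infix 3 _,_⊨ʷ_[_] _⊨ˡ_[_] _⊨_[_] _⊨⟨_⟩_[_]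

  _,_⊨ʷ_[_] : {P : 𝒫 AP} → Word P → ℕ → (ψ : LTL) → atoms ψ ⊆ P → Set
  w , i ⊨ʷ true [ h ]     = ⊤
  w , i ⊨ʷ atom p [ h ]   = T (w i p (h p (∈⁺ (λ q → q ≡ p) refl)))
  w , i ⊨ʷ ¬ˡ ψ [ h ]     = ¬ (w , i ⊨ʷ ψ [ h ])
  w , i ⊨ʷ ψ₁ ∧ˡ ψ₂ [ h ] = (w , i ⊨ʷ ψ₁ [ ∪-⊆ˡ h ]) × (w , i ⊨ʷ ψ₂ [ ∪-⊆ʳ h ])
  w , i ⊨ʷ ψ₁ ∨ˡ ψ₂ [ h ] = (w , i ⊨ʷ ψ₁ [ ∪-⊆ˡ h ]) ⊎ (w , i ⊨ʷ ψ₂ [ ∪-⊆ʳ h ])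
  w , i ⊨ʷ ○ ψ [ h ]      = w , suc i ⊨ʷ ψ [ h ]
  w , i ⊨ʷ ψ₁ 𝒰 ψ₂ [ h ]  =
    ∃[ k ] i ≤ k × (w , k ⊨ʷ ψ₂ [ ∪-⊆ʳ h ])
         × (∀ j → i ≤ j → j < k → w , j ⊨ʷ ψ₁ [ ∪-⊆ˡ h ])

  _⊨ˡ_[_] : {P : 𝒫 AP} → Asg P → (ψ : LTL) → atoms ψ ⊆ P → Set
  χ ⊨ˡ ψ [ h ] = word χ , 0 ⊨ʷ ψ [ h ]

  -- Tarski semantics
  _⊨_[_] : {P : 𝒫 AP} → Asg P → (φ : QPTL) → free φ ⊆ P → Set
  χ ⊨ ltl ψ [ h ]    = χ ⊨ˡ ψ [ h ]
  χ ⊨ `¬ φ [ h ]     = ¬ (χ ⊨ φ [ h ])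
  χ ⊨ φ₁ `∧ φ₂ [ h ] = (χ ⊨ φ₁ [ ∪-⊆ˡ h ]) × (χ ⊨ φ₂ [ ∪-⊆ʳ h ])
  χ ⊨ φ₁ `∨ φ₂ [ h ] = (χ ⊨ φ₁ [ ∪-⊆ˡ h ]) ⊎ (χ ⊨ φ₂ [ ∪-⊆ʳ h ])
  χ ⊨ `∃ p ∙ φ [ h ] = ∃[ f ] χ [ p ↦ f ] ⊨ φ [ ∖-⊆ h ]
  χ ⊨ `∀ p ∙ φ [ h ] = ∀ f → χ [ p ↦ f ] ⊨ φ [ ∖-⊆ h ]

  -- The index P is ap(𝒳).
  record IsHyperassignment {P : 𝒫 AP} (𝒳 : 𝒫 (𝒫 (Asg P))) : Set where
    field
      nonempty : Nonempty 𝒳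
      ∅∉       : ∀ X → X ∈ 𝒳 → Nonempty X

  -- The operations below are defined on all sets of sets of assignments.  On
  -- hyperassignments, dual, ext and the nonempty parts of a partition are again
  -- hyperassignments.
  --
  -- Function extensionality is not assumed, so ≡ on sets and assignments is
  -- intensional; in its presence ≡ is equality of sets and of assignments.

  record ChoiceFunction {P : 𝒫 AP} (𝒳 : 𝒫 (𝒫 (Asg P))) : Set where
    field
      choose   : ∀ X → X ∈ 𝒳 → Asg P
      choose-∈ : ∀ X (m : X ∈ 𝒳) → choose X m ∈ X

    img : 𝒫 (Asg P)
    img = ⟅ χ ∣ (∃[ X ] Σ[ m ∈ X ∈ 𝒳 ] χ ≡ choose X m) ⟆

  open ChoiceFunction public

  dual : {P : 𝒫 AP} → 𝒫 (𝒫 (Asg P)) → 𝒫 (𝒫 (Asg P))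
  dual 𝒳 = ⟅ Y ∣ (Σ[ c ∈ ChoiceFunction 𝒳 ] Y ≡ img c) ⟆

  record Partition {P : 𝒫 AP} (𝒳 𝒳₁ 𝒳₂ : 𝒫 (𝒫 (Asg P))) : Set where
    field
      disjoint : ∀ X → ¬ (X ∈ 𝒳₁ × X ∈ 𝒳₂)
      covers   : ∀ X → X ∈ 𝒳 ⇔ (X ∈ 𝒳₁ ⊎ X ∈ 𝒳₂)

  Functor : 𝒫 AP → Set
  Functor P = Asg P → TemporalValuation

  extAsg : {P : 𝒫 AP} → Asg P → Functor P → (p : AP) → Asg (P ∪ ｛ p ｝)
  extAsg χ F p = χ [ p ↦ F χ ]

  extSet : {P : 𝒫 AP} → 𝒫 (Asg P) → Functor P → (p : AP) → 𝒫 (Asg (P ∪ ｛ p ｝))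
  extSet X F p = ⟅ χ′ ∣ (∃[ χ ] χ ∈ X × χ′ ≡ extAsg χ F p) ⟆

  ext : {P : 𝒫 AP} → 𝒫 (𝒫 (Asg P)) → (p : AP) → 𝒫 (𝒫 (Asg (P ∪ ｛ p ｝)))
  ext {P} 𝒳 p = ⟅ Y ∣ (∃[ X ] Σ[ F ∈ Functor P ] X ∈ 𝒳 × Y ≡ extSet X F p) ⟆

  data Flag : Set where
    ∃∀ ∀∃ : Flag

  flip : Flag → Flag
  flip ∃∀ = ∀∃
  flip ∀∃ = ∃∀

  EveryPartition SomePartition :
    {P : 𝒫 AP} (S₁ S₂ : 𝒫 (𝒫 (Asg P)) → Set) → 𝒫 (𝒫 (Asg P)) → Set
  EveryPartition S₁ S₂ 𝒳 = ∀ 𝒳₁ 𝒳₂ → Partition 𝒳 𝒳₁ 𝒳₂ →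
    (Nonempty 𝒳₁ × S₁ 𝒳₁) ⊎ (Nonempty 𝒳₂ × S₂ 𝒳₂)
  SomePartition S₁ S₂ 𝒳 = ∃[ 𝒳₁ ] ∃[ 𝒳₂ ] Partition 𝒳 𝒳₁ 𝒳₂ ×
    (Nonempty 𝒳₁ → S₁ 𝒳₁) × (Nonempty 𝒳₂ → S₂ 𝒳₂)

  -- Alternating Hodges semantics.  A clause that passes to the dual with the
  -- same formula and the other flag is written with that flag's clause
  -- unfolded, so that the recursion is structural.
  _⊨⟨_⟩_[_] : {P : 𝒫 AP} → 𝒫 (𝒫 (Asg P)) → Flag → (φ : QPTL) → free φ ⊆ P → Set
  𝒳 ⊨⟨ ∃∀ ⟩ ltl ψ [ h ]    = ∃[ X ] X ∈ 𝒳 × (∀ χ → χ ∈ X → χ ⊨ˡ ψ [ h ])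
  𝒳 ⊨⟨ ∀∃ ⟩ ltl ψ [ h ]    = ∀ X → X ∈ 𝒳 → ∃[ χ ] χ ∈ X × (χ ⊨ˡ ψ [ h ])
  𝒳 ⊨⟨ α ⟩ `¬ φ [ h ]      = ¬ (𝒳 ⊨⟨ flip α ⟩ φ [ h ])
  𝒳 ⊨⟨ ∃∀ ⟩ φ₁ `∧ φ₂ [ h ] =
    EveryPartition (_⊨⟨ ∃∀ ⟩ φ₁ [ ∪-⊆ˡ h ]) (_⊨⟨ ∃∀ ⟩ φ₂ [ ∪-⊆ʳ h ]) 𝒳
  𝒳 ⊨⟨ ∀∃ ⟩ φ₁ `∧ φ₂ [ h ] =
    EveryPartition (_⊨⟨ ∃∀ ⟩ φ₁ [ ∪-⊆ˡ h ]) (_⊨⟨ ∃∀ ⟩ φ₂ [ ∪-⊆ʳ h ]) (dual 𝒳)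
  𝒳 ⊨⟨ ∀∃ ⟩ φ₁ `∨ φ₂ [ h ] =
    SomePartition (_⊨⟨ ∀∃ ⟩ φ₁ [ ∪-⊆ˡ h ]) (_⊨⟨ ∀∃ ⟩ φ₂ [ ∪-⊆ʳ h ]) 𝒳
  𝒳 ⊨⟨ ∃∀ ⟩ φ₁ `∨ φ₂ [ h ] =
    SomePartition (_⊨⟨ ∀∃ ⟩ φ₁ [ ∪-⊆ˡ h ]) (_⊨⟨ ∀∃ ⟩ φ₂ [ ∪-⊆ʳ h ]) (dual 𝒳)
  𝒳 ⊨⟨ ∃∀ ⟩ `∃ p ∙ φ [ h ] = ext 𝒳 p ⊨⟨ ∃∀ ⟩ φ [ ∖-⊆ h ]
  𝒳 ⊨⟨ ∀∃ ⟩ `∃ p ∙ φ [ h ] = ext (dual 𝒳) p ⊨⟨ ∃∀ ⟩ φ [ ∖-⊆ h ]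
  𝒳 ⊨⟨ ∀∃ ⟩ `∀ p ∙ φ [ h ] = ext 𝒳 p ⊨⟨ ∀∃ ⟩ φ [ ∖-⊆ h ]
  𝒳 ⊨⟨ ∃∀ ⟩ `∀ p ∙ φ [ h ] = ext (dual 𝒳) p ⊨⟨ ∀∃ ⟩ φ [ ∖-⊆ h ]

{-# OPTIONS --safe #-}
-- Both claims are proved together, by induction on φ.  Write SomeAll 𝒳 Q for
-- "some X ∈ 𝒳 lies inside Q" and AllSome 𝒳 Q for "every X ∈ 𝒳 meets Q".
-- Passing to the dual exchanges the two, so for every connective it is enough
-- to treat the flag whose clause does not dualise.  Partitions are chosen by
-- splitting 𝒳 according to whether X lies inside (meets) the extension of the
-- first subformula, and functors by choosing, for each χ, a suitable value for p.
module Submission where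

open import Defs
open import Level using (0ℓ)
open import Axiom.ExcludedMiddle using (ExcludedMiddle)
open import Data.Bool using (false)
open import Data.Product using (Σ-syntax; ∃-syntax; _×_; _,_; proj₁; proj₂)
open import Data.Sum using (_⊎_; inj₁; inj₂)
open import Data.Unit using (⊤; tt)
open import Function.Base using (_∘_)
open import Function.Bundles using (_⇔_; mk⇔; module Equivalence)
open import Function.Properties.Equivalence using ()
  renaming (refl to ⇔-refl; trans to ⇔-trans)
open import Relation.Binary.PropositionalEquality using (_≡_; refl)
open import Relation.Nullary using (¬_; Dec; yes; no; contradiction)
open import Relation.Nullary.Decidable using (decidable-stable)

module _ (em : ExcludedMiddle 0ℓ) (AP : Set) where

  open Semantics em AP
  open Equivalence using (to; from)

  -- Two quantifier patterns and their negations.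

  SomeAll AllSome : {A : Set} → 𝒫 (𝒫 A) → (A → Set) → Set
  SomeAll 𝒳 Q = ∃[ X ] X ∈ 𝒳 × (∀ χ → χ ∈ X → Q χ)
  AllSome 𝒳 Q = ∀ X → X ∈ 𝒳 → ∃[ χ ] χ ∈ X × Q χ

  Within : {A : Set} → 𝒫 A → (A → Set) → A → Set
  Within X Q x = x ∈ X × Q x

  module _ {A : Set} {𝒳 : 𝒫 (𝒫 A)} {Q : A → Set} where

    ¬SomeAll⇒AllSome¬ : ¬ SomeAll 𝒳 Q → AllSome 𝒳 (¬_ ∘ Q)
    -- `em` also decides Σ-types, so the double negation yields an actual element of `X`. Done for
    -- all `X` at once, this is a use of choice.
    ¬SomeAll⇒AllSome¬ ¬some X X∈𝒳 = decidable-stable em λ ¬∃ →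
      ¬some (X , X∈𝒳 , λ χ χ∈X → decidable-stable em λ ¬q → ¬∃ (χ , χ∈X , ¬q))

    ¬AllSome⇒SomeAll¬ : ¬ AllSome 𝒳 Q → SomeAll 𝒳 (¬_ ∘ Q)
    ¬AllSome⇒SomeAll¬ ¬all = decidable-stable em λ ¬some →
      ¬all λ X X∈𝒳 → decidable-stable em λ ¬∃ →
        ¬some (X , X∈𝒳 , λ χ χ∈X q → ¬∃ (χ , χ∈X , q))

    ¬AllSome⇔SomeAll¬ : (¬ AllSome 𝒳 Q) ⇔ SomeAll 𝒳 (¬_ ∘ Q)
    ¬AllSome⇔SomeAll¬ = mk⇔ ¬AllSome⇒SomeAll¬ λ (X , X∈𝒳 , ¬q) all →
      let χ , χ∈X , q = all X X∈𝒳 in ¬q χ χ∈X q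

    ¬SomeAll⇔AllSome¬ : (¬ SomeAll 𝒳 Q) ⇔ AllSome 𝒳 (¬_ ∘ Q)
    ¬SomeAll⇔AllSome¬ = mk⇔ ¬SomeAll⇒AllSome¬ λ all (X , X∈𝒳 , q) →
      let χ , χ∈X , ¬q = all X X∈𝒳 in ¬q (q χ χ∈X)

  ¬-cong-⇔ : {A B : Set} → A ⇔ B → (¬ A) ⇔ (¬ B)
  ¬-cong-⇔ e = mk⇔ (_∘ from e) (_∘ to e)

  -- Choice functions and the dual.

  module _ {P : 𝒫 AP} {𝒳 : 𝒫 (𝒫 (Asg P))} where

    -- `InImage` and `IsImage` name the predicates behind `img` and `dual`, because `∈⁺` and `∈⁻`
    -- take the predicate explicitly.
    InImage : ChoiceFunction 𝒳 → Asg P → Set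
    InImage c χ = ∃[ X ] Σ[ X∈𝒳 ∈ X ∈ 𝒳 ] χ ≡ choose c X X∈𝒳

    IsImage : 𝒫 (Asg P) → Set
    IsImage Y = Σ[ c ∈ ChoiceFunction 𝒳 ] Y ≡ img c

    choose∈img : (c : ChoiceFunction 𝒳) {X : 𝒫 (Asg P)} (X∈𝒳 : X ∈ 𝒳) →
      choose c X X∈𝒳 ∈ img c
    choose∈img c X∈𝒳 = ∈⁺ (InImage c) (_ , X∈𝒳 , refl)

    img∈dual : (c : ChoiceFunction 𝒳) → img c ∈ dual 𝒳
    img∈dual c = ∈⁺ IsImage (c , refl)

    -- The existential is a Σ-type, so the hypothesis already contains the choice function as its
    -- first projections.
    choice : {Q : Asg P → Set} → AllSome 𝒳 Q →
      ∃[ c ] (∀ χ → χ ∈ img {𝒳 = 𝒳} c → Q χ)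
    choice {Q} all = c , λ χ χ∈img → img⊆Q (∈⁻ (InImage c) χ∈img)
      where
        c : ChoiceFunction 𝒳
        c = record
          { choose   = λ X X∈𝒳 → proj₁ (all X X∈𝒳)
          ; choose-∈ = λ X X∈𝒳 → proj₁ (proj₂ (all X X∈𝒳))
          }

        img⊆Q : {χ : Asg P} → InImage c χ → Q χ
        img⊆Q (X , X∈𝒳 , refl) = proj₂ (proj₂ (all X X∈𝒳))

    dual-isHyperassignment : IsHyperassignment 𝒳 → IsHyperassignment (dual 𝒳)
    dual-isHyperassignment H = record
      -- The trivial property `⊤` is enough to obtain some choice function; `∅∉` supplies its
      -- values.
      { nonempty = let c , _ = choice {λ _ → ⊤} λ X X∈𝒳 →
                         let χ , χ∈X = H.∅∉ X X∈𝒳 in χ , χ∈X , tt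
                   in img c , img∈dual c
      ; ∅∉       = λ Y Y∈dual → img-nonempty (∈⁻ IsImage Y∈dual)
      }
      where
        module H = IsHyperassignment H

        img-nonempty : {Y : 𝒫 (Asg P)} → IsImage Y → Nonempty Y
        img-nonempty (c , refl) = let X , X∈𝒳 = H.nonempty in
          choose c X X∈𝒳 , choose∈img c X∈𝒳

    -- A choice function with image inside `Q` is the same thing as a choice of a `Q`-element in
    -- every member of `𝒳`.
    SomeAll-dual : {Q : Asg P → Set} → SomeAll (dual 𝒳) Q ⇔ AllSome 𝒳 Q
    SomeAll-dual {Q} = mk⇔
      (λ (Y , Y∈dual , q) → some⇒all (∈⁻ IsImage Y∈dual) q)
      (λ all → let c , q = choice all in img c , img∈dual c , q)
      where
        some⇒all : {Y : 𝒫 (Asg P)} → IsImage Y →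
          (∀ χ → χ ∈ Y → Q χ) → AllSome 𝒳 Q
        some⇒all (c , refl) q X X∈𝒳 =
          choose c X X∈𝒳 , choose-∈ c X X∈𝒳 , q _ (choose∈img c X∈𝒳)

    -- If no `X` lay inside `Q`, choosing an element outside `Q` from each would give an image that
    -- misses `Q`. Conversely, every choice function picks a `Q`-element from an `X` inside `Q`.
    AllSome-dual : {Q : Asg P → Set} → AllSome (dual 𝒳) Q ⇔ SomeAll 𝒳 Q
    AllSome-dual {Q} = mk⇔
      (decidable-stable em ∘ all⇒¬¬some)
      (λ some Y Y∈dual → some⇒all some (∈⁻ IsImage Y∈dual))
      where
        all⇒¬¬some : AllSome (dual 𝒳) Q → ¬ ¬ SomeAll 𝒳 Q
        all⇒¬¬some all ¬some =
          let c , ¬q = choice (¬SomeAll⇒AllSome¬ ¬some)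
              χ , χ∈img , q = all (img c) (img∈dual c)
          in ¬q χ χ∈img q

        some⇒all : SomeAll 𝒳 Q → {Y : 𝒫 (Asg P)} →
          IsImage Y → ∃[ χ ] χ ∈ Y × Q χ
        some⇒all (X , X∈𝒳 , q) (c , refl) =
          choose c X X∈𝒳 , choose∈img c X∈𝒳 , q _ (choose-∈ c X X∈𝒳)

    -- Parts of a partition.

    part-isHyperassignment : {𝒴 : 𝒫 (𝒫 (Asg P))} → IsHyperassignment 𝒳 →
      𝒴 ⊆ 𝒳 → Nonempty 𝒴 → IsHyperassignment 𝒴
    part-isHyperassignment H 𝒴⊆𝒳 ne = record
      { nonempty = ne
      ; ∅∉       = λ X X∈𝒴 → IsHyperassignment.∅∉ H X (𝒴⊆𝒳 X X∈𝒴)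
      }

    separate : (Q : 𝒫 (Asg P) → Set) →
      Partition 𝒳 (comprehension (Within 𝒳 Q)) (comprehension (Within 𝒳 (¬_ ∘ Q)))
    separate Q = record
      { disjoint = λ X (X∈𝒳₁ , X∈𝒳₂) →
          proj₂ (∈⁻ (Within 𝒳 (¬_ ∘ Q)) X∈𝒳₂) (proj₂ (∈⁻ (Within 𝒳 Q) X∈𝒳₁))
      ; covers   = λ X → mk⇔ (cases em)
          (λ { (inj₁ X∈𝒳₁) → proj₁ (∈⁻ (Within 𝒳 Q) X∈𝒳₁)
             ; (inj₂ X∈𝒳₂) → proj₁ (∈⁻ (Within 𝒳 (¬_ ∘ Q)) X∈𝒳₂) })
      }
      where
        cases : {X : 𝒫 (Asg P)} → Dec (Q X) → X ∈ 𝒳 →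
          X ∈ comprehension (Within 𝒳 Q) ⊎ X ∈ comprehension (Within 𝒳 (¬_ ∘ Q))
        cases (yes q) X∈𝒳 = inj₁ (∈⁺ (Within 𝒳 Q) (X∈𝒳 , q))
        cases (no ¬q) X∈𝒳 = inj₂ (∈⁺ (Within 𝒳 (¬_ ∘ Q)) (X∈𝒳 , ¬q))

    within-isHyperassignment : IsHyperassignment 𝒳 → (Q : 𝒫 (Asg P) → Set) →
      Nonempty (comprehension (Within 𝒳 Q)) →
      IsHyperassignment (comprehension (Within 𝒳 Q))
    within-isHyperassignment H Q =
      part-isHyperassignment H λ X → proj₁ ∘ ∈⁻ (Within 𝒳 Q)

  -- Boolean connectives, for arbitrary semantic predicates.

  Captures-∃∀ Captures-∀∃ :
    {P : 𝒫 AP} → (𝒫 (𝒫 (Asg P)) → Set) → (Asg P → Set) → Set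
  Captures-∃∀ S Q = ∀ 𝒳 → IsHyperassignment 𝒳 → S 𝒳 ⇔ SomeAll 𝒳 Q
  Captures-∀∃ S Q = ∀ 𝒳 → IsHyperassignment 𝒳 → S 𝒳 ⇔ AllSome 𝒳 Q

  module _ {P : 𝒫 AP} {S : 𝒫 (𝒫 (Asg P)) → Set} {Q : Asg P → Set} where

    -- A clause that passes to the dual is `S ∘ dual` by definition, where `S` is the clause for the
    -- other flag.
    dualise-∃∀ : Captures-∃∀ S Q → Captures-∀∃ (S ∘ dual) Q
    dualise-∃∀ e 𝒳 H =
      ⇔-trans (e (dual 𝒳) (dual-isHyperassignment H)) SomeAll-dual

    dualise-∀∃ : Captures-∀∃ S Q → Captures-∃∀ (S ∘ dual) Q
    dualise-∀∃ e 𝒳 H =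
      ⇔-trans (e (dual 𝒳) (dual-isHyperassignment H)) AllSome-dual

  module _ {P : 𝒫 AP} {S₁ S₂ : 𝒫 (𝒫 (Asg P)) → Set} {Q₁ Q₂ : Asg P → Set} where

    -- Putting the sets that are not inside `Q₁` into the first part makes the first alternative
    -- impossible; the second gives a set inside `Q₂` that is also inside `Q₁`. Conversely, a set
    -- inside both witnesses whichever part it falls into.
    everyPartition : Captures-∃∀ S₁ Q₁ → Captures-∃∀ S₂ Q₂ →
      Captures-∃∀ (EveryPartition S₁ S₂) (λ χ → Q₁ χ × Q₂ χ)
    everyPartition e₁ e₂ 𝒳 H = mk⇔ ⇒ ⇐
      where
        NotInside : 𝒫 (Asg P) → Set
        NotInside X = ¬ (∀ χ → χ ∈ X → Q₁ χ)

        ⇒ : EveryPartition S₁ S₂ 𝒳 → SomeAll 𝒳 (λ χ → Q₁ χ × Q₂ χ)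
        ⇒ every with every _ _ (separate NotInside)
        ... | inj₁ (ne , s) =
          let X , X∈𝒳₁ , q₁ = to (e₁ _ (within-isHyperassignment H _ ne)) s
          in contradiction q₁ (proj₂ (∈⁻ (Within 𝒳 NotInside) X∈𝒳₁))
        ... | inj₂ (ne , s) =
          let X , X∈𝒳₂ , q₂ = to (e₂ _ (within-isHyperassignment H _ ne)) s
              X∈𝒳 , ¬¬q₁ = ∈⁻ (Within 𝒳 (¬_ ∘ NotInside)) X∈𝒳₂
          in X , X∈𝒳 , λ χ χ∈X → decidable-stable em ¬¬q₁ χ χ∈X , q₂ χ χ∈X

        ⇐ : SomeAll 𝒳 (λ χ → Q₁ χ × Q₂ χ) → EveryPartition S₁ S₂ 𝒳
        ⇐ (X , X∈𝒳 , q) 𝒳₁ 𝒳₂ π with to (Partition.covers π X) X∈𝒳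
        ... | inj₁ X∈𝒳₁ = inj₁ ((X , X∈𝒳₁) , from
          (e₁ 𝒳₁ (part-isHyperassignment H
            (λ Y → from (Partition.covers π Y) ∘ inj₁) (X , X∈𝒳₁)))
          (X , X∈𝒳₁ , λ χ χ∈X → proj₁ (q χ χ∈X)))
        ... | inj₂ X∈𝒳₂ = inj₂ ((X , X∈𝒳₂) , from
          (e₂ 𝒳₂ (part-isHyperassignment H
            (λ Y → from (Partition.covers π Y) ∘ inj₂) (X , X∈𝒳₂)))
          (X , X∈𝒳₂ , λ χ χ∈X → proj₂ (q χ χ∈X)))

    -- The sets meeting `Q₁` form the first part. A set in the other part must owe its witness to
    -- `Q₂`.
    somePartition : Captures-∀∃ S₁ Q₁ → Captures-∀∃ S₂ Q₂ →
      Captures-∀∃ (SomePartition S₁ S₂) (λ χ → Q₁ χ ⊎ Q₂ χ)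
    somePartition e₁ e₂ 𝒳 H = mk⇔ ⇒ ⇐
      where
        Meets : 𝒫 (Asg P) → Set
        Meets X = ∃[ χ ] χ ∈ X × Q₁ χ

        ⇒ : SomePartition S₁ S₂ 𝒳 → AllSome 𝒳 (λ χ → Q₁ χ ⊎ Q₂ χ)
        ⇒ (𝒳₁ , 𝒳₂ , π , s₁ , s₂) X X∈𝒳 with to (Partition.covers π X) X∈𝒳
        ... | inj₁ X∈𝒳₁ =
          let ne = X , X∈𝒳₁
              H₁ = part-isHyperassignment H
                     (λ Y → from (Partition.covers π Y) ∘ inj₁) ne
              χ , χ∈X , q = to (e₁ 𝒳₁ H₁) (s₁ ne) X X∈𝒳₁
          in χ , χ∈X , inj₁ q
        ... | inj₂ X∈𝒳₂ =
          let ne = X , X∈𝒳₂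
              H₂ = part-isHyperassignment H
                     (λ Y → from (Partition.covers π Y) ∘ inj₂) ne
              χ , χ∈X , q = to (e₂ 𝒳₂ H₂) (s₂ ne) X X∈𝒳₂
          in χ , χ∈X , inj₂ q

        Q₂-remains : ∀ {X} → ∃[ χ ] χ ∈ X × (Q₁ χ ⊎ Q₂ χ) →
          ¬ Meets X → ∃[ χ ] χ ∈ X × Q₂ χ
        Q₂-remains (χ , χ∈X , inj₁ q₁) ¬∃ = contradiction (χ , χ∈X , q₁) ¬∃
        Q₂-remains (χ , χ∈X , inj₂ q₂) ¬∃ = χ , χ∈X , q₂

        ⇐ : AllSome 𝒳 (λ χ → Q₁ χ ⊎ Q₂ χ) → SomePartition S₁ S₂ 𝒳
        ⇐ all = _ , _ , separate Meets ,
          (λ ne → from (e₁ _ (within-isHyperassignment H _ ne))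
            (λ X X∈𝒳₁ → proj₂ (∈⁻ (Within 𝒳 Meets) X∈𝒳₁))) ,
          (λ ne → from (e₂ _ (within-isHyperassignment H _ ne))
            (λ X X∈𝒳₂ → let X∈𝒳 , ¬∃ = ∈⁻ (Within 𝒳 (¬_ ∘ Meets)) X∈𝒳₂ in
              Q₂-remains (all X X∈𝒳) ¬∃))

  -- Functors and the quantifiers.

  witnessFunctor : {P : 𝒫 AP} (R : Asg P → TemporalValuation → Set) →
    ∃[ F ] (∀ χ → ∃[ f ] R χ f → R χ (F χ))
  witnessFunctor R = (λ χ → value em) , λ χ → value-correct em
    where
      -- The decision is an argument so that `value-correct` can match on the one that computes the
      -- value.
      value : ∀ {χ} → Dec (∃[ f ] R χ f) → TemporalValuation
      value (yes (f , _)) = f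
      -- An arbitrary default: correctness is claimed only where a witness exists.
      value (no _)        = λ _ → false

      value-correct : ∀ {χ} (d : Dec (∃[ f ] R χ f)) → ∃[ f ] R χ f → R χ (value d)
      value-correct (yes (_ , r)) _ = r
      value-correct (no ¬∃)       ∃f = contradiction ∃f ¬∃

  module _ {P : 𝒫 AP} {𝒳 : 𝒫 (𝒫 (Asg P))} {p : AP} where

    IsExtension : 𝒫 (Asg (P ∪ ｛ p ｝)) → Set
    IsExtension Y = ∃[ X ] Σ[ F ∈ Functor P ] X ∈ 𝒳 × Y ≡ extSet X F p

    Extends : 𝒫 (Asg P) → Functor P → Asg (P ∪ ｛ p ｝) → Set
    Extends X F χ′ = ∃[ χ ] χ ∈ X × χ′ ≡ extAsg χ F p

    extSet∈ext : {X : 𝒫 (Asg P)} → X ∈ 𝒳 → (F : Functor P) → extSet X F p ∈ ext 𝒳 p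
    extSet∈ext X∈𝒳 F = ∈⁺ IsExtension (_ , F , X∈𝒳 , refl)

    extAsg∈extSet : {X : 𝒫 (Asg P)} {χ : Asg P} → χ ∈ X → (F : Functor P) →
      extAsg χ F p ∈ extSet X F p
    extAsg∈extSet χ∈X F = ∈⁺ (Extends _ F) (_ , χ∈X , refl)

    extSet-all : {X : 𝒫 (Asg P)} {F : Functor P} {Q : Asg (P ∪ ｛ p ｝) → Set} →
      (∀ χ → χ ∈ X → Q (extAsg χ F p)) → ∀ χ → χ ∈ extSet X F p → Q χ
    extSet-all {X} {F} {Q} q χ χ∈ext = unfold (∈⁻ (Extends X F) χ∈ext)
      where
        unfold : ∀ {χ} → Extends X F χ → Q χ
        unfold (χ₀ , χ₀∈X , refl) = q χ₀ χ₀∈X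

    ext-all : {R : 𝒫 (Asg (P ∪ ｛ p ｝)) → Set} →
      (∀ X → X ∈ 𝒳 → ∀ F → R (extSet X F p)) → ∀ Y → Y ∈ ext 𝒳 p → R Y
    ext-all {R} r Y Y∈ext = unfold (∈⁻ IsExtension Y∈ext)
      where
        unfold : ∀ {Y} → IsExtension Y → R Y
        unfold (X , F , X∈𝒳 , refl) = r X X∈𝒳 F

    ext-isHyperassignment : IsHyperassignment 𝒳 → IsHyperassignment (ext 𝒳 p)
    ext-isHyperassignment H = record
      { nonempty = let X , X∈𝒳 = H.nonempty in
                   _ , extSet∈ext X∈𝒳 (λ _ _ → false)
      ; ∅∉       = ext-all λ X X∈𝒳 F →
                   let χ , χ∈X = H.∅∉ X X∈𝒳 in _ , extAsg∈extSet χ∈X F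
      }
      where module H = IsHyperassignment H

    module _ {Q : Asg (P ∪ ｛ p ｝) → Set} where

      -- A functor sees the whole assignment, so witnesses `f` chosen separately for each `χ`
      -- assemble into one functor; conversely `F χ` is the witness at `χ`.
      SomeAll-ext : SomeAll (ext 𝒳 p) Q ⇔ SomeAll 𝒳 (λ χ → ∃[ f ] Q (χ [ p ↦ f ]))
      SomeAll-ext = mk⇔
        -- The hypothesis on `Y` is moved into the motive, since `Y` gets replaced by an `extSet`.
        (λ (Y , Y∈ext , q) → ext-all
          {λ Y → (∀ χ → χ ∈ Y → Q χ) → SomeAll 𝒳 (λ χ → ∃[ f ] Q (χ [ p ↦ f ]))}
          (λ X X∈𝒳 F q → X , X∈𝒳 , λ χ χ∈X → F χ , q _ (extAsg∈extSet χ∈X F))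
          Y Y∈ext q)
        (λ (X , X∈𝒳 , q) →
          let F , r = witnessFunctor (λ χ f → Q (χ [ p ↦ f ]))
          in _ , extSet∈ext X∈𝒳 F , extSet-all (λ χ χ∈X → r χ (q χ χ∈X)))

      -- If in some `X` every `χ` had a bad value for `p`, a functor selecting bad values would
      -- produce an extension of `X` that misses `Q`.
      AllSome-ext : AllSome (ext 𝒳 p) Q ⇔ AllSome 𝒳 (λ χ → ∀ f → Q (χ [ p ↦ f ]))
      AllSome-ext = mk⇔
        (decidable-stable em ∘ all⇒¬¬all)
        (λ all → ext-all λ X X∈𝒳 F →
          let χ , χ∈X , q = all X X∈𝒳 in _ , extAsg∈extSet χ∈X F , q (F χ))
        where
          all⇒¬¬all : AllSome (ext 𝒳 p) Q →
            ¬ ¬ AllSome 𝒳 (λ χ → ∀ f → Q (χ [ p ↦ f ]))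
          all⇒¬¬all all ¬all =
            let X , X∈𝒳 , ¬q = ¬AllSome⇒SomeAll¬ ¬all
                F , r = witnessFunctor (λ χ f → ¬ Q (χ [ p ↦ f ]))
                χ , χ∈ext , q = all _ (extSet∈ext X∈𝒳 F)
            in extSet-all {Q = ¬_ ∘ Q}
                 (λ χ χ∈X → r χ (decidable-stable em λ ¬∃ → ¬q χ χ∈X λ f →
                   decidable-stable em λ ¬qf → ¬∃ (f , ¬qf)))
                 χ χ∈ext q

  -- Induction on formulas.

  adequate : ∀ φ {P} (h : free φ ⊆ P) →
    Captures-∃∀ (_⊨⟨ ∃∀ ⟩ φ [ h ]) (_⊨ φ [ h ]) ×
    Captures-∀∃ (_⊨⟨ ∀∃ ⟩ φ [ h ]) (_⊨ φ [ h ])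
  adequate (ltl ψ) h = (λ _ _ → ⇔-refl) , (λ _ _ → ⇔-refl)
  adequate (`¬ φ) h =
    -- Negation flips the flag, so each claim uses the induction hypothesis of the other.
    (λ 𝒳 H → ⇔-trans (¬-cong-⇔ (proj₂ (adequate φ h) 𝒳 H)) ¬AllSome⇔SomeAll¬) ,
    (λ 𝒳 H → ⇔-trans (¬-cong-⇔ (proj₁ (adequate φ h) 𝒳 H)) ¬SomeAll⇔AllSome¬)
  adequate (φ₁ `∧ φ₂) h = conjunction , dualise-∃∀ conjunction
    where
      conjunction = everyPartition
        (proj₁ (adequate φ₁ (∪-⊆ˡ h))) (proj₁ (adequate φ₂ (∪-⊆ʳ h)))
  adequate (φ₁ `∨ φ₂) h = dualise-∀∃ disjunction , disjunction
    where
      disjunction = somePartition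
        (proj₂ (adequate φ₁ (∪-⊆ˡ h))) (proj₂ (adequate φ₂ (∪-⊆ʳ h)))
  adequate (`∃ p ∙ φ) h = existential , dualise-∃∀ existential
    where
      existential : Captures-∃∀ (_⊨⟨ ∃∀ ⟩ `∃ p ∙ φ [ h ]) (_⊨ `∃ p ∙ φ [ h ])
      existential 𝒳 H = ⇔-trans
        -- The hypothesis is applied over the larger domain `P ∪ ｛ p ｝`, which is why `P` varies in
        -- the induction.
        (proj₁ (adequate φ (∖-⊆ h)) (ext 𝒳 p) (ext-isHyperassignment H)) SomeAll-ext
  adequate (`∀ p ∙ φ) h = dualise-∀∃ universal , universal
    where
      universal : Captures-∀∃ (_⊨⟨ ∀∃ ⟩ `∀ p ∙ φ [ h ]) (_⊨ `∀ p ∙ φ [ h ])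
      universal 𝒳 H = ⇔-trans
        (proj₂ (adequate φ (∖-⊆ h)) (ext 𝒳 p) (ext-isHyperassignment H)) AllSome-ext

mainTheorem5 : (em : ExcludedMiddle 0ℓ) (AP : Set) → let open Semantics em AP in
    (φ : QPTL) (P : 𝒫 AP) (free⊆P : free φ ⊆ P) (𝒳 : 𝒫 (𝒫 (Asg P))) → IsHyperassignment 𝒳 →
    ((𝒳 ⊨⟨ ∃∀ ⟩ φ [ free⊆P ]) ⇔ (∃[ X ] X ∈ 𝒳 × (∀ χ → χ ∈ X → χ ⊨ φ [ free⊆P ])))
    × ((𝒳 ⊨⟨ ∀∃ ⟩ φ [ free⊆P ]) ⇔ (∀ X → X ∈ 𝒳 → ∃[ χ ] χ ∈ X × (χ ⊨ φ [ free⊆P ])))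
mainTheorem5 em AP φ P free⊆P 𝒳 H =
  let some , all = adequate em AP φ free⊆P in some 𝒳 H , all 𝒳 H
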